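{- Let $X=\bigcup_{n\ge1}X_n$ be a positively graded set. The space $K[T_{\infty,X}]=\bigoplus_{n\ge1}K[T_{n,X}]$ of planar rooted trees with vertices coloured by $X$, with the operations $t\bullet_iw:=t\circ_iw$ (grafting), is a grafting algebra, and it is the free grafting algebra on $X$: for every grafting algebra $A$ and every map $\varphi:X\to A$ with $\varphi(X_n)\subseteq A_n$, there is a unique degree-preserving linear map $\Phi:K[T_{\infty,X}]\to A$ with $\Phi(t\circ_iw)=\Phi(t)\bullet_i\Phi(w)$ for all $t,w$ and $0\le i\le|w|$, and $\Phi(\mathfrak c_n,x)=\varphi(x)$ for $x\in X_n$. In particular the free grafting algebra on one generator of degree $1$ is spanned by planar binary rooted trees.
   Context: A preshuffle algebra is a graded vector space $A=\bigoplus_{n\ge0}A_n$ over a field $K$ with linear maps $\bullet_i:A_n\otimes A_m\to A_{n+m}$ for all $n,m\ge0$ and $0\le i\le m$, such that $(x\bullet_iy)\bullet_jz=x\bullet_{i+j}(y\bullet_jz)$ for all homogeneous $x,y,z$, $0\le i\le|y|$, $0\le j\le|z|$. A grafting algebra is a preshuffle algebra which moreover satisfies $x\bullet_i(y\bullet_jz)=y\bullet_{j+|x|}(x\bullet_iz)$ for all homogeneous $x,y,z$ and $0\le i<j\le|z|$. A planar rooted tree is a planar tree with a root, in which every internal vertex has at least two incoming edges and one outgoing edge; the leaves of a tree with $n+1$ leaves are numbered $0,\dots,n$ from left to right, and the tree has degree $n$ ($n\ge1$). $T_{n,X}$ is the set of planar rooted trees with $n+1$ leaves whose internal vertices are coloured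 by elements of $X$ so that a vertex with $k+1$ incoming edges is coloured by an element of $X_k$. For coloured trees $t,w$ and $0\le i\le|w|$, $t\circ_iw$ is the coloured tree obtained by attaching the root of $t$ to the $i$-th leaf of $w$; it has degree $|t|+|w|$. $(\mathfrak c_n,x)$ denotes the corolla with $n+1$ leaves and one vertex, coloured by $x\in X_n$. -}

module Defs where

open import Level using (Level; _⊔_) renaming (suc to lsuc)
open import Algebra.Apartness.Bundles using (HeytingField; HeytingCommutativeRing)
open import Algebra.Bundles using (CommutativeRing)
open import Algebra.Module.Bundles using (LeftModule)
open import Algebra.Module.Morphism.Structures using (module LeftModuleMorphisms)
open import Data.List.Base as List using (List; []; _∷_; _++_; cartesianProductWith)
open import Data.List.Properties using (++-assoc; ++-identityʳ; map-++)
open import Data.Nat.Base using (ℕ; zero; suc; _+_; _∸_; _≤_; _<_; s≤s; z≤n)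
open import Data.Nat.Properties
  using ( _<?_; +-assoc; +-comm; +-suc; +-identityʳ; +-mono-≤; +-monoˡ-≤; +-cancelˡ-<
        ; ≤-trans; ≤-reflexive; <⇒≤; <-≤-trans; m≤m+n; m≤n+m; ≮⇒≥; m+[n∸m]≡n; suc-injective)
open import Data.Product.Base using (_×_; _,_)
open import Data.Tree.Binary as Binary using (#leaves)
open import Data.Unit.Base using (⊤)
open import Data.Vec.Base using (Vec; []; _∷_; replicate)
open import Relation.Binary.Core using (Rel)
open import Relation.Binary.PropositionalEquality.Core
  using (_≡_; refl; sym; trans; cong; cong₂; subst)
open import Relation.Nullary.Decidable.Core using (yes; no)

private
  variable
    c ℓ₁ ℓ₂ m ℓm s x : Level
    d e k : ℕ

record PositivelyGradedSet (x : Level) : Set (lsuc x) where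
  field
    Elem     : ℕ → Set x
    positive : ∀ {n} → Elem n → 1 ≤ n

open PositivelyGradedSet public

-- `leaf` is the tree without vertices.  A vertex coloured by an element of
-- degree k has k + 1 incoming edges, hence at least two by `positive`.

data PlanarTree (X : PositivelyGradedSet x) : Set x where
  leaf : PlanarTree X
  node : ∀ {k} → Elem X k → Vec (PlanarTree X) (suc k) → PlanarTree X

module _ {X : PositivelyGradedSet x} where

  mutual
    leaves : PlanarTree X → ℕ
    leaves leaf        = 1
    leaves (node _ ts) = leavesᵛ ts

    leavesᵛ : Vec (PlanarTree X) k → ℕ
    leavesᵛ []       = 0
    leavesᵛ (t ∷ ts) = leaves t + leavesᵛ ts

  -- graft t i w attaches the root of t to the leaf number i of w, leaves being
  -- numbered from 0, left to right.  Only i < leaves w is meaningful.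

  mutual
    graft : PlanarTree X → ℕ → PlanarTree X → PlanarTree X
    graft t i leaf        = t
    graft t i (node y ws) = node y (graftᵛ t i ws)

    graftᵛ : PlanarTree X → ℕ → Vec (PlanarTree X) k → Vec (PlanarTree X) k
    graftᵛ t i []       = []
    graftᵛ t i (w ∷ ws) with i <? leaves w
    ... | yes _ = graft t i w ∷ ws
    ... | no  _ = w ∷ graftᵛ t (i ∸ leaves w) ws

  mutual
    leaves-graft : ∀ t i w → i < leaves w → suc (leaves (graft t i w)) ≡ leaves t + leaves w
    leaves-graft t i leaf        _ = +-comm 1 (leaves t)
    leaves-graft t i (node _ ws) p = leaves-graftᵛ t i ws p

    leaves-graftᵛ : ∀ t i (ws : Vec (PlanarTree X) k) → i < leavesᵛ ws →
                    suc (leavesᵛ (graftᵛ t i ws)) ≡ leaves t + leavesᵛ ws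
    leaves-graftᵛ t i (w ∷ ws) p with i <? leaves w
    ... | yes q = trans (cong (_+ leavesᵛ ws) (leaves-graft t i w q))
                        (+-assoc (leaves t) (leaves w) (leavesᵛ ws))
    ... | no ¬q =
      trans (sym (+-suc (leaves w) _))
      (trans (cong (leaves w +_) (leaves-graftᵛ t (i ∸ leaves w) ws q))
      (trans (sym (+-assoc (leaves w) (leaves t) (leavesᵛ ws)))
      (trans (cong (_+ leavesᵛ ws) (+-comm (leaves w) (leaves t)))
             (+-assoc (leaves t) (leaves w) (leavesᵛ ws)))))
      where
      q : i ∸ leaves w < leavesᵛ ws
      q = +-cancelˡ-< (leaves w) _ _ (subst (_< leaves w + leavesᵛ ws) (sym (m+[n∸m]≡n (≮⇒≥ ¬q))) p)

  leaves-replicate : ∀ k → leavesᵛ (replicate k leaf) ≡ k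
  leaves-replicate zero    = refl
  leaves-replicate (suc k) = cong suc (leaves-replicate k)

-- The set T_{n,X}; it is empty for n = 0.

record T (X : PositivelyGradedSet x) (n : ℕ) : Set x where
  constructor mkT
  field
    tree      : PlanarTree X
    .leaves≡  : leaves tree ≡ suc n
    .positive : 1 ≤ n

open T public using (tree)

module _ {X : PositivelyGradedSet x} where

  infixr 7 _∘⟨_,_⟩_

  _∘⟨_,_⟩_ : T X d → (i : ℕ) → .(i ≤ e) → T X e → T X (d + e)
  _∘⟨_,_⟩_ {d} {e} (mkT t lt pt) i i≤e (mkT w lw _) =
    mkT (graft t i w)
        (suc-injective (trans (leaves-graft t i w (subst (i <_) (sym lw) (s≤s i≤e)))
                       (trans (cong₂ _+_ lt lw) (cong suc (+-suc d e)))))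
        (≤-trans pt (m≤m+n d e))

  corolla : ∀ {n} → Elem X n → T X n
  corolla {n} y = mkT (node y (replicate (suc n) leaf)) (leaves-replicate (suc n)) (positive X y)

data Generator : ℕ → Set where
  gen : Generator 1

oneGenerator : PositivelyGradedSet _
oneGenerator = record { Elem = Generator ; positive = λ { gen → s≤s z≤n } }

record BinaryTree (n : ℕ) : Set where
  constructor mkB
  field
    tree      : Binary.Tree ⊤ ⊤
    .leaves≡  : #leaves tree ≡ suc n
    .positive : 1 ≤ n

fromBinary : Binary.Tree ⊤ ⊤ → PlanarTree oneGenerator
fromBinary (Binary.leaf _)     = leaf
fromBinary (Binary.node l _ r) = node gen (fromBinary l ∷ fromBinary r ∷ [])

leaves-fromBinary : ∀ b → leaves (fromBinary b) ≡ #leaves b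
leaves-fromBinary (Binary.leaf _)     = refl
leaves-fromBinary (Binary.node l _ r) =
  cong₂ _+_ (leaves-fromBinary l) (trans (+-identityʳ _) (leaves-fromBinary r))

colour : ∀ {n} → BinaryTree n → T oneGenerator n
colour (mkB b lb pb) = mkT (fromBinary b) (trans (leaves-fromBinary b) lb) pb

swap-degrees : ∀ p q r → p + (q + r) ≡ q + (p + r)
swap-degrees p q r =
  trans (sym (+-assoc p q r)) (trans (cong (_+ r) (+-comm p q)) (+-assoc q p r))

shift-≤ : ∀ {j r} p → j ≤ r → j + p ≤ p + r
shift-≤ {j} {r} p j≤r = ≤-trans (+-monoˡ-≤ p j≤r) (≤-reflexive (+-comm r p))

module _ (K : HeytingField c ℓ₁ ℓ₂) where

  private
    commutativeRing : CommutativeRing c ℓ₁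
    commutativeRing = HeytingCommutativeRing.commutativeRing (HeytingField.heytingCommutativeRing K)

  open CommutativeRing commutativeRing
    using ( Carrier; _≈_; 0#; 1#; -_; ring; *-cong; *-assoc; *-identityˡ; zeroˡ; zeroʳ
          ; distribˡ; distribʳ; -‿inverseʳ)
    renaming (_+_ to _+ᴷ_; _*_ to _*ᴷ_; refl to ≈-refl; sym to ≈-sym; trans to ≈-trans)

  VectorSpace : ∀ m ℓm → Set (c ⊔ ℓ₁ ⊔ lsuc (m ⊔ ℓm))
  VectorSpace = LeftModule ring

  ∣_∣ : VectorSpace m ℓm → Set m
  ∣_∣ = LeftModule.Carrierᴹ

  module _ {m₁ ℓm₁ m₂ ℓm₂} (U : VectorSpace m₁ ℓm₁) (V : VectorSpace m₂ ℓm₂) where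
    open LeftModuleMorphisms (LeftModule.rawLeftModule U) (LeftModule.rawLeftModule V) public
      using () renaming (IsLeftModuleHomomorphism to IsLinear; IsLeftModuleIsomorphism to IsLinearIso)

  -- Linear maps out of U ⊗ V are given as bilinear maps on U × V.

  record IsBilinear {m₁ ℓm₁ m₂ ℓm₂ m₃ ℓm₃}
    (U : VectorSpace m₁ ℓm₁) (V : VectorSpace m₂ ℓm₂) (W : VectorSpace m₃ ℓm₃)
    (f : ∣ U ∣ → ∣ V ∣ → ∣ W ∣) : Set (c ⊔ m₁ ⊔ ℓm₁ ⊔ m₂ ⊔ ℓm₂ ⊔ ℓm₃) where
    field
      linearˡ : ∀ v → IsLinear U W (λ u → f u v)
      linearʳ : ∀ u → IsLinear V W (f u)

  -- A graded vector space is the family of its homogeneous components.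

  GradedSpace : ∀ m ℓm → Set (c ⊔ ℓ₁ ⊔ lsuc (m ⊔ ℓm))
  GradedSpace m ℓm = ℕ → VectorSpace m ℓm

  Operations : GradedSpace m ℓm → Set m
  Operations A = ∀ {d e} → ∣ A d ∣ → (i : ℕ) → .(i ≤ e) → ∣ A e ∣ → ∣ A (d + e) ∣

  module _ (A : GradedSpace m ℓm) where

    infix 4 _≈[_]_

    -- Equality of homogeneous elements whose degrees are only propositionally equal.
    _≈[_]_ : ∣ A d ∣ → d ≡ e → ∣ A e ∣ → Set ℓm
    _≈[_]_ {d} {e} u d≡e v = LeftModule._≈ᴹ_ (A e) (subst (λ n → ∣ A n ∣) d≡e u) v

    record IsPreshuffleAlgebra (_•⟨_,_⟩_ : Operations A) : Set (c ⊔ m ⊔ ℓm) where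
      field
        bilinear : ∀ {d e} i .(i≤e : i ≤ e) →
                   IsBilinear (A d) (A e) (A (d + e)) (λ u v → u •⟨ i , i≤e ⟩ v)
        assoc    : ∀ {p q r} (u : ∣ A p ∣) (v : ∣ A q ∣) (w : ∣ A r ∣)
                   i (i≤q : i ≤ q) j (j≤r : j ≤ r) →
                   ((u •⟨ i , i≤q ⟩ v) •⟨ j , j≤r ⟩ w)
                     ≈[ +-assoc p q r ]
                   (u •⟨ i + j , +-mono-≤ i≤q j≤r ⟩ (v •⟨ j , j≤r ⟩ w))

    record IsGraftingAlgebra (_•⟨_,_⟩_ : Operations A) : Set (c ⊔ m ⊔ ℓm) where
      field
        isPreshuffleAlgebra : IsPreshuffleAlgebra _•⟨_,_⟩_
        exchange : ∀ {p q r} (u : ∣ A p ∣) (v : ∣ A q ∣) (w : ∣ A r ∣)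
                   i j (i<j : i < j) (j≤r : j ≤ r) →
                   (u •⟨ i , ≤-trans (<⇒≤ (<-≤-trans i<j j≤r)) (m≤n+m r q) ⟩ (v •⟨ j , j≤r ⟩ w))
                     ≈[ swap-degrees p q r ]
                   (v •⟨ j + p , shift-≤ p j≤r ⟩ (u •⟨ i , <⇒≤ (<-≤-trans i<j j≤r) ⟩ w))

      open IsPreshuffleAlgebra isPreshuffleAlgebra public

  record GraftingAlgebra m ℓm : Set (c ⊔ ℓ₁ ⊔ lsuc (m ⊔ ℓm)) where
    field
      space             : GradedSpace m ℓm
      _•⟨_,_⟩_          : Operations space
      isGraftingAlgebra : IsGraftingAlgebra space _•⟨_,_⟩_

    open IsGraftingAlgebra isGraftingAlgebra public

  -- Elements are formal linear combinations a₁ s₁ + … + aₙ sₙ.  Since S need not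
  -- have decidable equality, coefficients cannot be compared; instead two
  -- combinations are equal if one is obtained from the other by replacing
  -- coefficients by equal ones, permuting terms, collecting two terms with the
  -- same basis element, and deleting terms with coefficient 0.

  FormalSum : Set s → Set (c ⊔ s)
  FormalSum S = List (Carrier × S)

  module _ {S : Set s} where

    infix 4 _≋_

    data _≋_ : Rel (FormalSum S) (c ⊔ ℓ₁ ⊔ s) where
      ≋-refl  : ∀ {us} → us ≋ us
      ≋-sym   : ∀ {us vs} → us ≋ vs → vs ≋ us
      ≋-trans : ∀ {us vs ws} → us ≋ vs → vs ≋ ws → us ≋ ws
      ∷-cong  : ∀ {a b y us vs} → a ≈ b → us ≋ vs → (a , y) ∷ us ≋ (b , y) ∷ vs
      swap    : ∀ u v us → u ∷ v ∷ us ≋ v ∷ u ∷ us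
      collect : ∀ a b y us → (a , y) ∷ (b , y) ∷ us ≋ (a +ᴷ b , y) ∷ us
      delete  : ∀ y us → (0# , y) ∷ us ≋ us

    basis : S → FormalSum S
    basis y = (1# , y) ∷ []

    mapCoeff : (Carrier → Carrier) → FormalSum S → FormalSum S
    mapCoeff f = List.map (λ (a , y) → f a , y)

    private
      ≋-reflexive : ∀ {us vs} → us ≡ vs → us ≋ vs
      ≋-reflexive refl = ≋-refl

      ++-congˡ : ∀ us {vs ws} → vs ≋ ws → us ++ vs ≋ us ++ ws
      ++-congˡ []       p = p
      ++-congˡ (_ ∷ us) p = ∷-cong ≈-refl (++-congˡ us p)

      ++-congʳ : ∀ ws {us vs} → us ≋ vs → us ++ ws ≋ vs ++ ws
      ++-congʳ ws ≋-refl            = ≋-refl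
      ++-congʳ ws (≋-sym p)         = ≋-sym (++-congʳ ws p)
      ++-congʳ ws (≋-trans p q)     = ≋-trans (++-congʳ ws p) (++-congʳ ws q)
      ++-congʳ ws (∷-cong e p)      = ∷-cong e (++-congʳ ws p)
      ++-congʳ ws (swap u v us)     = swap u v (us ++ ws)
      ++-congʳ ws (collect a b y us) = collect a b y (us ++ ws)
      ++-congʳ ws (delete y us)     = delete y (us ++ ws)

      shift : ∀ u us vs → us ++ u ∷ vs ≋ u ∷ (us ++ vs)
      shift u []        vs = ≋-refl
      shift u (u′ ∷ us) vs = ≋-trans (∷-cong ≈-refl (shift u us vs)) (swap u′ u (us ++ vs))

      ++-comm : ∀ us vs → us ++ vs ≋ vs ++ us
      ++-comm []       vs = ≋-reflexive (sym (++-identityʳ vs))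
      ++-comm (u ∷ us) vs = ≋-trans (∷-cong ≈-refl (++-comm us vs)) (≋-sym (shift u vs us))

      mapCoeff-cong : ∀ {f g} → (∀ {a b} → a ≈ b → f a ≈ g b) →
                      (∀ a b → f (a +ᴷ b) ≈ f a +ᴷ f b) → f 0# ≈ 0# →
                      ∀ {us vs} → us ≋ vs → mapCoeff f us ≋ mapCoeff g vs
      mapCoeff-cong {f} {g} f≈g f+ f0 = λ p → ≋-trans (go p) (change _)
        where
        f-cong : ∀ {a b} → a ≈ b → f a ≈ f b
        f-cong p = ≈-trans (f≈g p) (≈-sym (f≈g ≈-refl))

        change : ∀ us → mapCoeff f us ≋ mapCoeff g us
        change []       = ≋-refl
        change (_ ∷ us) = ∷-cong (f≈g ≈-refl) (change us)

        go : ∀ {us vs} → us ≋ vs → mapCoeff f us ≋ mapCoeff f vs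
        go ≋-refl             = ≋-refl
        go (≋-sym p)          = ≋-sym (go p)
        go (≋-trans p q)      = ≋-trans (go p) (go q)
        go (∷-cong e p)       = ∷-cong (f-cong e) (go p)
        go (swap _ _ us)      = swap _ _ _
        go (collect a b y us) = ≋-trans (collect _ _ y _) (∷-cong (≈-sym (f+ a b)) ≋-refl)
        go (delete y us)      = ≋-trans (∷-cong f0 ≋-refl) (delete y _)

      collect₀ : ∀ {a b} y {us} → a +ᴷ b ≈ 0# → (a , y) ∷ (b , y) ∷ us ≋ us
      collect₀ y p = ≋-trans (collect _ _ y _) (≋-trans (∷-cong p ≋-refl) (delete y _))

      inverseʳ : ∀ us → us ++ mapCoeff -_ us ≋ []
      inverseʳ []             = ≋-refl
      inverseʳ ((a , y) ∷ us) =
        ≋-trans (∷-cong ≈-refl (shift (- a , y) us (mapCoeff -_ us)))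
        (≋-trans (collect₀ y (-‿inverseʳ a)) (inverseʳ us))

      inverseˡ : ∀ us → mapCoeff -_ us ++ us ≋ []
      inverseˡ us = ≋-trans (++-comm (mapCoeff -_ us) us) (inverseʳ us)

      neg-cong : ∀ {us vs} → us ≋ vs → mapCoeff -_ us ≋ mapCoeff -_ vs
      neg-cong {us} {vs} p =
        ≋-trans (≋-reflexive (sym (++-identityʳ (mapCoeff -_ us))))
        (≋-trans (++-congˡ (mapCoeff -_ us) (≋-sym (inverseʳ vs)))
        (≋-trans (≋-reflexive (sym (++-assoc (mapCoeff -_ us) vs _)))
                 (++-congʳ (mapCoeff -_ vs)
                   (≋-trans (++-congˡ (mapCoeff -_ us) (≋-sym p)) (inverseˡ us)))))

      scale-0 : ∀ us → mapCoeff (0# *ᴷ_) us ≋ []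
      scale-0 []             = ≋-refl
      scale-0 ((a , y) ∷ us) = ≋-trans (∷-cong (zeroˡ a) (scale-0 us)) (delete y [])

      scale-1 : ∀ us → mapCoeff (1# *ᴷ_) us ≋ us
      scale-1 []             = ≋-refl
      scale-1 ((a , y) ∷ us) = ∷-cong (*-identityˡ a) (scale-1 us)

      scale-* : ∀ a b us → mapCoeff ((a *ᴷ b) *ᴷ_) us ≋ mapCoeff (a *ᴷ_) (mapCoeff (b *ᴷ_) us)
      scale-* a b []             = ≋-refl
      scale-* a b ((r , y) ∷ us) = ∷-cong (*-assoc a b r) (scale-* a b us)

      scale-+ : ∀ us a b → mapCoeff ((a +ᴷ b) *ᴷ_) us ≋ mapCoeff (a *ᴷ_) us ++ mapCoeff (b *ᴷ_) us
      scale-+ []             a b = ≋-refl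
      scale-+ ((r , y) ∷ us) a b =
        ≋-trans (∷-cong (distribʳ r a b) (scale-+ us a b))
        (≋-trans (≋-sym (collect (a *ᴷ r) (b *ᴷ r) y _))
                 (∷-cong ≈-refl (≋-sym (shift _ (mapCoeff (a *ᴷ_) us) _))))

    freeLeftModule : VectorSpace (c ⊔ s) (c ⊔ ℓ₁ ⊔ s)
    freeLeftModule = record
      { Carrierᴹ = FormalSum S
      ; _≈ᴹ_     = _≋_
      ; _+ᴹ_     = _++_
      ; _*ₗ_     = λ a → mapCoeff (a *ᴷ_)
      ; 0ᴹ       = []
      ; -ᴹ_      = mapCoeff -_
      ; isLeftModule = record
        { isLeftSemimodule = record
          { +ᴹ-isCommutativeMonoid = record
            { isMonoid = record
              { isSemigroup = record
                { isMagma = record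
                  { isEquivalence = record { refl = ≋-refl ; sym = ≋-sym ; trans = ≋-trans }
                  ; ∙-cong = λ {us} {_} {_} {ws} p q → ≋-trans (++-congˡ us q) (++-congʳ ws p)
                  }
                ; assoc = λ us vs ws → ≋-reflexive (++-assoc us vs ws)
                }
              ; identity = (λ _ → ≋-refl) , (λ us → ≋-reflexive (++-identityʳ us))
              }
            ; comm = ++-comm
            }
          ; isPreleftSemimodule = record
            { *ₗ-cong      = λ {a} a≈b p → mapCoeff-cong (*-cong a≈b) (distribˡ a) (zeroʳ a) p
            ; *ₗ-zeroˡ     = scale-0
            ; *ₗ-distribʳ  = scale-+
            ; *ₗ-identityˡ = scale-1
            ; *ₗ-assoc     = scale-*
            ; *ₗ-zeroʳ     = λ _ → ≋-refl
            ; *ₗ-distribˡ  = λ a us vs → ≋-reflexive (map-++ _ us vs)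
            }
          }
        ; -ᴹ‿cong    = neg-cong
        ; -ᴹ‿inverse = inverseˡ , inverseʳ
        }
      }

  K[_] : Set s → VectorSpace (c ⊔ s) (c ⊔ ℓ₁ ⊔ s)
  K[ S ] = freeLeftModule {S = S}

  extend : ∀ {s′} {S : Set s} {S′ : Set s′} → (S → S′) → FormalSum S → FormalSum S′
  extend f = List.map (λ (a , y) → a , f y)

  K[T∞,_] : PositivelyGradedSet x → GradedSpace (c ⊔ x) (c ⊔ ℓ₁ ⊔ x)
  K[T∞, X ] n = K[ T X n ]

  -- The bilinear extension of t , w ↦ t ∘ᵢ w.
  grafting : (X : PositivelyGradedSet x) → Operations K[T∞, X ]
  grafting X us i i≤e vs =
    cartesianProductWith (λ (a , t) (b , w) → a *ᴷ b , (t ∘⟨ i , i≤e ⟩ w)) us vs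

  module _ (X : PositivelyGradedSet x) (A : GraftingAlgebra m ℓm) where
    open GraftingAlgebra A using (space; _•⟨_,_⟩_)

    GradedMap : Set (c ⊔ x ⊔ m)
    GradedMap = ∀ n → FormalSum (T X n) → ∣ space n ∣

    record Extends (φ : ∀ n → Elem X n → ∣ space n ∣) (Φ : GradedMap) : Set (c ⊔ ℓ₁ ⊔ x ⊔ m ⊔ ℓm) where
      field
        linear   : ∀ n → IsLinear K[ T X n ] (space n) (Φ n)
        grafts   : ∀ {d e} (t : T X d) (w : T X e) i .(i≤e : i ≤ e) →
                   LeftModule._≈ᴹ_ (space (d + e))
                     (Φ (d + e) (basis (t ∘⟨ i , i≤e ⟩ w)))
                     (Φ d (basis t) •⟨ i , i≤e ⟩ Φ e (basis w))
        corollas : ∀ n (y : Elem X n) →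
                   LeftModule._≈ᴹ_ (space n) (Φ n (basis (corolla y))) (φ n y)

{-# OPTIONS --safe #-}

-- Idea.  In a grafting algebra A every tree t acts on the elements h of degree ≥ i
-- by an operator act t i: the tree without vertices acts as the identity, and
-- t = node y (t₀ ∷ … ∷ tₖ) acts as eval t •ᵢ_, where
--   eval t = act t₀ 0 (act t₁ 1 (… (act tₖ k (φ y)))).
-- Grafting onto the leaves of a corolla from right to left leaves the numbers of the
-- leaves still to be treated unchanged, so no index has to be corrected.  That eval
-- is compatible with grafting follows by induction on the lower tree: descending
-- into the child which carries the leaf uses associativity, and passing the children
-- on its left uses the exchange law.  Applied to the corolla of y itself, the formula
-- for eval t says that t is generated by corollas, which gives uniqueness.
module Submission where

open import Defs
open import Level using (Level; _⊔_)
open import Algebra.Apartness.Bundles using (HeytingField; HeytingCommutativeRing)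
open import Algebra.Bundles using (CommutativeMonoid; CommutativeRing)
open import Algebra.Module.Bundles using (LeftModule)
import Algebra.Module.Morphism.Construct.Composition as Composition
import Algebra.Module.Morphism.Construct.Identity as Identity
open import Algebra.Module.Morphism.Structures using (module LeftModuleMorphisms)
open import Algebra.Module.Properties.LeftModule using (inverseˡ-uniqueᴹ)
import Algebra.Properties.CommutativeSemigroup as CommutativeSemigroupProperties
open import Data.Empty using (⊥; ⊥-elim-irr)
open import Data.List.Base using (List; []; _∷_; _++_)
open import Data.List.Properties using (map-∘; map-++; map-cong; map-id)
open import Data.Nat.Base using (ℕ; zero; suc; _+_; _∸_; _≤_; _<_; s≤s; s≤s⁻¹; z≤n)
open import Data.Nat.Properties hiding (*-identityʳ; *-identityˡ; *-assoc; *-comm)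
open import Data.Nat.Tactic.RingSolver using (solve-∀)
open import Data.Product.Base using (_×_; Σ-syntax; ∃-syntax; _,_; proj₁; proj₂)
open import Data.Sum.Base using (_⊎_; inj₁; inj₂)
open import Data.Tree.Binary as Binary using (#leaves)
open import Data.Unit.Base using (⊤; tt)
open import Data.Vec.Base using (Vec; []; _∷_; replicate)
open import Function.Base using (_∘_)
open import Relation.Binary.Bundles using (Setoid)
open import Relation.Binary.PropositionalEquality as ≡ using (_≡_; cong; cong₂; subst; subst₂)
import Relation.Binary.Reasoning.Setoid as SetoidReasoning
open import Relation.Nullary.Decidable.Core using (Dec; yes; no; recompute)
open import Relation.Nullary.Negation.Core using (contradiction; contradiction-irr)

private
  variable
    c ℓ₁ ℓ₂ m ℓm m′ ℓm′ m″ ℓm″ s s₁ s₂ s₃ x : Level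
    d e k n p q r : ℕ

-- Grafting of planar trees

-- The second case presents the index as a sum rather than through `∸`: matching on the equation
-- then substitutes it, and `graftᵛ-skip` applies as stated.
split : ∀ m i → i < m ⊎ (∃[ i′ ] i ≡ m + i′)
split m i with i <? m
... | yes i<m = inj₁ i<m
... | no  i≮m = inj₂ (i ∸ m , ≡.sym (m+[n∸m]≡n (≮⇒≥ i≮m)))

module _ {X : PositivelyGradedSet x} where

  leaves-positive : (t : PlanarTree X) → 1 ≤ leaves t
  leaves-positive leaf              = ≤-refl
  leaves-positive (node _ (t ∷ ts)) = ≤-trans (leaves-positive t) (m≤m+n _ _)

  leavesᵛ-≥ : (ts : Vec (PlanarTree X) k) → k ≤ leavesᵛ ts
  leavesᵛ-≥ []       = z≤n
  leavesᵛ-≥ (t ∷ ts) = +-mono-≤ (leaves-positive t) (leavesᵛ-≥ ts)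

  graftᵛ-hit : ∀ t {i} (w : PlanarTree X) (ws : Vec (PlanarTree X) k) → i < leaves w →
               graftᵛ t i (w ∷ ws) ≡ graft t i w ∷ ws
  graftᵛ-hit t {i} w ws i<w with i <? leaves w
  ... | yes _  = ≡.refl
  ... | no i≮w = contradiction i<w i≮w

  graftᵛ-skip : ∀ t i (w : PlanarTree X) (ws : Vec (PlanarTree X) k) →
                graftᵛ t (leaves w + i) (w ∷ ws) ≡ w ∷ graftᵛ t i ws
  graftᵛ-skip t i w ws with leaves w + i <? leaves w
  ... | yes p = contradiction p (m+n≮m (leaves w) i)
  ... | no _  = cong (λ j → w ∷ graftᵛ t j ws) (m+n∸m≡n (leaves w) i)

  leaves-graft-≥ : ∀ t {i} (w : PlanarTree X) → i < leaves w → leaves w ≤ leaves (graft t i w)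
  leaves-graft-≥ t {i} w i<w = s≤s⁻¹ (≤-trans (+-monoˡ-≤ (leaves w) (leaves-positive t))
                                             (≤-reflexive (≡.sym (leaves-graft t i w i<w))))

  -- Leaf `i` of the upper tree becomes leaf `i + j` of the result. The two strict bounds leave room
  -- for the one leaf that grafting consumes.
  <-leaves-graft : ∀ t {i j} (w : PlanarTree X) → i < leaves t → j < leaves w →
                   i + j < leaves (graft t j w)
  <-leaves-graft t {i} {j} w i<t j<w = s≤s⁻¹ (begin
    suc (suc (i + j))          ≡⟨ cong suc (+-suc i j) ⟨
    suc i + suc j              ≤⟨ +-mono-≤ i<t j<w ⟩
    leaves t + leaves w        ≡⟨ leaves-graft t j w j<w ⟨
    suc (leaves (graft t j w)) ∎)
    where open ≤-Reasoning

  leaves-graft-+ : ∀ t {i p} (w : PlanarTree X) → leaves t ≡ suc p → i < leaves w →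
                   leaves (graft t i w) ≡ p + leaves w
  leaves-graft-+ t {i} w t≡ i<w =
    suc-injective (≡.trans (leaves-graft t i w i<w) (cong (_+ leaves w) t≡))

  mutual
    -- Induction on the lowest tree. Both sides change only the child that carries leaf `j`: if it
    -- is the first one, the identity descends into it, otherwise the first child is skipped on both
    -- sides.
    graft-assoc : ∀ t v (w : PlanarTree X) {i j} → i < leaves v → j < leaves w →
                  graft (graft t i v) j w ≡ graft t (i + j) (graft v j w)
    graft-assoc t v leaf {i} {zero} _ _ = cong (λ i → graft t i v) (≡.sym (+-identityʳ i))
    graft-assoc t v leaf {j = suc _} _ (s≤s ())
    graft-assoc t v (node y ws) i<v j<w = cong (node y) (graft-assocᵛ t v ws i<v j<w)

    graft-assocᵛ : ∀ t v (ws : Vec (PlanarTree X) k) {i j} → i < leaves v → j < leavesᵛ ws →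
                   graftᵛ (graft t i v) j ws ≡ graftᵛ t (i + j) (graftᵛ v j ws)
    graft-assocᵛ t v (w ∷ ws) {i} {j} i<v j<ws with split (leaves w) j
    ... | inj₁ j<w = begin
      graftᵛ (graft t i v) j (w ∷ ws)     ≡⟨ graftᵛ-hit (graft t i v) w ws j<w ⟩
      graft (graft t i v) j w ∷ ws        ≡⟨ cong (_∷ ws) (graft-assoc t v w i<v j<w) ⟩
      graft t (i + j) (graft v j w) ∷ ws  ≡⟨ graftᵛ-hit t _ ws (<-leaves-graft v w i<v j<w) ⟨
      graftᵛ t (i + j) (graft v j w ∷ ws) ≡⟨ cong (graftᵛ t (i + j)) (graftᵛ-hit v w ws j<w) ⟨
      graftᵛ t (i + j) (graftᵛ v j (w ∷ ws)) ∎
      where open ≡.≡-Reasoning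
    ... | inj₂ (j′ , ≡.refl) = begin
      graftᵛ (graft t i v) (leaves w + j′) (w ∷ ws) ≡⟨ graftᵛ-skip (graft t i v) j′ w ws ⟩
      w ∷ graftᵛ (graft t i v) j′ ws
        ≡⟨ cong (w ∷_) (graft-assocᵛ t v ws i<v (+-cancelˡ-< (leaves w) _ _ j<ws)) ⟩
      w ∷ graftᵛ t (i + j′) (graftᵛ v j′ ws)
        ≡⟨ graftᵛ-skip t (i + j′) w _ ⟨
      graftᵛ t (leaves w + (i + j′)) (w ∷ graftᵛ v j′ ws)
        ≡⟨ cong₂ (graftᵛ t) (swap-degrees (leaves w) i j′) (≡.sym (graftᵛ-skip v j′ w ws)) ⟩
      graftᵛ t (i + (leaves w + j′)) (graftᵛ v (leaves w + j′) (w ∷ ws)) ∎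
      where open ≡.≡-Reasoning

  mutual
    -- If both leaves lie in the same child, induction applies; if they lie in different children,
    -- the two graftings do not interact. The shift `p` records the leaves that `t` adds to the left
    -- of leaf `j`.
    graft-exchange : ∀ t v (w : PlanarTree X) {i j p} → leaves t ≡ suc p → i < j → j < leaves w →
                     graft t i (graft v j w) ≡ graft v (j + p) (graft t i w)
    graft-exchange t v leaf t≡ () (s≤s z≤n)
    graft-exchange t v (node y ws) t≡ i<j j<w = cong (node y) (graft-exchangeᵛ t v ws t≡ i<j j<w)

    graft-exchangeᵛ : ∀ t v (ws : Vec (PlanarTree X) k) {i j p} →
                      leaves t ≡ suc p → i < j → j < leavesᵛ ws →
                      graftᵛ t i (graftᵛ v j ws) ≡ graftᵛ v (j + p) (graftᵛ t i ws)
    graft-exchangeᵛ t v (w ∷ ws) {i} {j} {p} t≡ i<j j<ws with split (leaves w) i | split (leaves w) j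
    ... | inj₁ i<w | inj₁ j<w = begin
      graftᵛ t i (graftᵛ v j (w ∷ ws))       ≡⟨ cong (graftᵛ t i) (graftᵛ-hit v w ws j<w) ⟩
      graftᵛ t i (graft v j w ∷ ws)
        ≡⟨ graftᵛ-hit t _ ws (<-≤-trans i<w (leaves-graft-≥ v w j<w)) ⟩
      graft t i (graft v j w) ∷ ws           ≡⟨ cong (_∷ ws) (graft-exchange t v w t≡ i<j j<w) ⟩
      graft v (j + p) (graft t i w) ∷ ws     ≡⟨ graftᵛ-hit v _ ws j+p< ⟨
      graftᵛ v (j + p) (graft t i w ∷ ws)    ≡⟨ cong (graftᵛ v (j + p)) (graftᵛ-hit t w ws i<w) ⟨
      graftᵛ v (j + p) (graftᵛ t i (w ∷ ws)) ∎
      where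
      open ≡.≡-Reasoning
      j+p< : j + p < leaves (graft t i w)
      j+p< = ≤-trans (+-monoˡ-≤ p j<w)
                     (≤-reflexive (≡.trans (+-comm (leaves w) p) (≡.sym (leaves-graft-+ t w t≡ i<w))))
    ... | inj₁ i<w | inj₂ (j′ , ≡.refl) = begin
      graftᵛ t i (graftᵛ v j (w ∷ ws))         ≡⟨ cong (graftᵛ t i) (graftᵛ-skip v j′ w ws) ⟩
      graftᵛ t i (w ∷ graftᵛ v j′ ws)          ≡⟨ graftᵛ-hit t w _ i<w ⟩
      graft t i w ∷ graftᵛ v j′ ws             ≡⟨ graftᵛ-skip v j′ (graft t i w) ws ⟨
      graftᵛ v (leaves (graft t i w) + j′) (graft t i w ∷ ws)
        ≡⟨ cong₂ (graftᵛ v) j+p≡ (≡.sym (graftᵛ-hit t w ws i<w)) ⟩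
      graftᵛ v (j + p) (graftᵛ t i (w ∷ ws))   ∎
      where
      open ≡.≡-Reasoning
      rearrange : ∀ a b c → a + b + c ≡ b + c + a
      rearrange = solve-∀
      j+p≡ : leaves (graft t i w) + j′ ≡ leaves w + j′ + p
      j+p≡ = ≡.trans (cong (_+ j′) (leaves-graft-+ t w t≡ i<w)) (rearrange p (leaves w) j′)
    -- Leaf `i` is to the left of leaf `j`, so it cannot lie in a later child.
    ... | inj₂ (i′ , ≡.refl) | inj₁ j<w = contradiction (<-trans i<j j<w) (m+n≮m (leaves w) i′)
    ... | inj₂ (i′ , ≡.refl) | inj₂ (j′ , ≡.refl) = begin
      graftᵛ t i (graftᵛ v j (w ∷ ws))         ≡⟨ cong (graftᵛ t i) (graftᵛ-skip v j′ w ws) ⟩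
      graftᵛ t i (w ∷ graftᵛ v j′ ws)          ≡⟨ graftᵛ-skip t i′ w _ ⟩
      w ∷ graftᵛ t i′ (graftᵛ v j′ ws)
        ≡⟨ cong (w ∷_) (graft-exchangeᵛ t v ws t≡ (+-cancelˡ-< (leaves w) _ _ i<j)
                                                  (+-cancelˡ-< (leaves w) _ _ j<ws)) ⟩
      w ∷ graftᵛ v (j′ + p) (graftᵛ t i′ ws)   ≡⟨ graftᵛ-skip v (j′ + p) w _ ⟨
      graftᵛ v (leaves w + (j′ + p)) (w ∷ graftᵛ t i′ ws)
        ≡⟨ cong₂ (graftᵛ v) (≡.sym (+-assoc (leaves w) j′ p)) (≡.sym (graftᵛ-skip t i′ w ws)) ⟩
      graftᵛ v (j + p) (graftᵛ t i (w ∷ ws))   ∎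
      where open ≡.≡-Reasoning

  mutual
    -- The tree `leaf` is a unit for grafting but belongs to no `T X n`. This is why children that
    -- are leaves can be passed over when trees are built up inside `T`.
    graft-leaf : ∀ i (w : PlanarTree X) → graft leaf i w ≡ w
    graft-leaf i leaf        = ≡.refl
    graft-leaf i (node y ws) = cong (node y) (graftᵛ-leaf i ws)

    graftᵛ-leaf : ∀ i (ws : Vec (PlanarTree X) k) → graftᵛ leaf i ws ≡ ws
    graftᵛ-leaf i []       = ≡.refl
    graftᵛ-leaf i (w ∷ ws) with i <? leaves w
    ... | yes _ = cong (_∷ ws) (graft-leaf i w)
    ... | no  _ = cong (w ∷_) (graftᵛ-leaf (i ∸ leaves w) ws)

  -- The leaves i , i + 1 , … of w are treated from right to left, so that none of
  -- them has to be renumbered.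
  graftAll : ℕ → Vec (PlanarTree X) k → PlanarTree X → PlanarTree X
  graftAll i []       w = w
  graftAll i (t ∷ ts) w = graft t i (graftAll (suc i) ts w)

  graftAllᵛ : ∀ {m} → ℕ → Vec (PlanarTree X) m → Vec (PlanarTree X) k → Vec (PlanarTree X) k
  graftAllᵛ i []       ws = ws
  graftAllᵛ i (t ∷ ts) ws = graftᵛ t i (graftAllᵛ (suc i) ts ws)

  graftAll-node : ∀ {m} i (ts : Vec (PlanarTree X) m) {k} (y : Elem X k) ws →
                  graftAll i ts (node y ws) ≡ node y (graftAllᵛ i ts ws)
  graftAll-node i []       y ws = ≡.refl
  graftAll-node i (t ∷ ts) y ws = cong (graft t i) (graftAll-node (suc i) ts y ws)

  -- A bare leaf in front occupies exactly one number, so it shifts every position by one.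
  graftAllᵛ-skip : ∀ {m} i (ts : Vec (PlanarTree X) m) (ws : Vec (PlanarTree X) k) →
                   graftAllᵛ (suc i) ts (leaf ∷ ws) ≡ leaf ∷ graftAllᵛ i ts ws
  graftAllᵛ-skip i []       ws = ≡.refl
  graftAllᵛ-skip i (t ∷ ts) ws =
    ≡.trans (cong (graftᵛ t (suc i)) (graftAllᵛ-skip (suc i) ts ws))
          (graftᵛ-skip t i leaf (graftAllᵛ (suc i) ts ws))

  -- Once the later positions have been filled, the leaf at position 0 is still bare, and the first
  -- tree replaces it.
  graftAllᵛ-leaves : (ts : Vec (PlanarTree X) k) → graftAllᵛ 0 ts (replicate k leaf) ≡ ts
  graftAllᵛ-leaves []       = ≡.refl
  graftAllᵛ-leaves (t ∷ ts) =
    ≡.trans (cong (graftᵛ t 0) (≡.trans (graftAllᵛ-skip 0 ts _) (cong (leaf ∷_) (graftAllᵛ-leaves ts))))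
          (graftᵛ-hit t leaf ts ≤-refl)

  -- Each tree with a vertex arises from the corolla of its root by grafting its children. Iterated,
  -- this shows that the corollas generate.
  graftAll-corolla : (y : Elem X k) (ts : Vec (PlanarTree X) (suc k)) →
                     graftAll 0 ts (tree (corolla y)) ≡ node y ts
  graftAll-corolla y ts = ≡.trans (graftAll-node 0 ts y _) (cong (node y) (graftAllᵛ-leaves ts))

-- Trees of a given degree

module _ {X : PositivelyGradedSet x} where

  -- The stored proof is irrelevant; a relevant one is recovered because equality of natural numbers
  -- is decidable.
  leaves-T : (t : T X d) → leaves (tree t) ≡ suc d
  leaves-T (mkT _ lt _) = recompute (_ ≟ _) lt

  <-leaves-T : (t : T X d) {i : ℕ} → i ≤ d → i < leaves (tree t)
  <-leaves-T t {i} i≤d = subst (i <_) (≡.sym (leaves-T t)) (s≤s i≤d)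

  T-≡ : (d≡e : d ≡ e) {t : T X d} {u : T X e} → tree t ≡ tree u → subst (T X) d≡e t ≡ u
  T-≡ ≡.refl ≡.refl = ≡.refl

  -- Reduces an identity between one-term combinations in propositionally equal degrees to an
  -- identity of the underlying trees.
  subst-single : ∀ {a} {C : Set a} (d≡e : d ≡ e) {b : C} {t : T X d} {u : T X e} → tree t ≡ tree u →
                 subst (λ n → List (C × T X n)) d≡e ((b , t) ∷ []) ≡ (b , u) ∷ []
  subst-single ≡.refl ≡.refl = ≡.refl

  nodeᵀ : ∀ {k} (y : Elem X k) ts → T X (leavesᵛ ts ∸ 1)
  nodeᵀ y ts = mkT (node y ts)
    (≡.sym (m+[n∸m]≡n (≤-trans (s≤s z≤n) (leavesᵛ-≥ ts))))
    -- Since `1 ≤ k`, the root has at least two children, each with at least one leaf.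
    (∸-monoˡ-≤ 1 (≤-trans (s≤s (positive X y)) (leavesᵛ-≥ ts)))

  -- Realises `graftAll` inside `T`, where `Ψ` can be applied. The hypothesis says that `w` has
  -- leaves `i , … , i + m - 1`; the bound `e ≤ n` keeps the next position in range. Children that
  -- are leaves change nothing.
  graftAllᵀ : ∀ {m} i (ts : Vec (PlanarTree X) m) (w : T X e) → i + m ≤ suc e →
               Σ[ n ∈ ℕ ] Σ[ u ∈ T X n ] tree u ≡ graftAll i ts (tree w) × e ≤ n
  graftAllᵀ i [] w _ = _ , w , ≡.refl , ≤-refl
  graftAllᵀ {e = e} i (t ∷ ts) w p with graftAllᵀ (suc i) ts w (≤-trans (≤-reflexive (≡.sym (+-suc i _))) p)
  graftAllᵀ i (leaf ∷ ts) w p | n , u , u≡ , e≤n = n , u , ≡.trans u≡ (≡.sym (graft-leaf i _)) , e≤n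
  graftAllᵀ {e = e} i (node y ts′ ∷ ts) w p | n , u , u≡ , e≤n =
    _ , nodeᵀ y ts′ ∘⟨ i , i≤n ⟩ u , cong (graft (node y ts′) i) u≡ , ≤-trans e≤n (m≤n+m n _)
    where
    i≤n : i ≤ n
    i≤n = ≤-trans (m+n≤o⇒m≤o i (s≤s⁻¹ (≤-trans (≤-reflexive (≡.sym (+-suc i _))) p))) e≤n

-- Linear maps out of free modules

module LinearAlgebra (K : HeytingField c ℓ₁ ℓ₂) where

  commutativeRing : CommutativeRing c ℓ₁
  commutativeRing = HeytingCommutativeRing.commutativeRing (HeytingField.heytingCommutativeRing K)

  open CommutativeRing commutativeRing
    using (0#; 1#; *-identityʳ; *-assoc; *-comm)
    renaming (_*_ to _*ᴷ_; refl to ≈-refl; sym to ≈-sym)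

  module Linear {m ℓm m′ ℓm′} {U : VectorSpace K m ℓm} {V : VectorSpace K m′ ℓm′} {f : ∣_∣ K U → ∣_∣ K V}
    (f-linear : IsLinear K U V f) =
    LeftModuleMorphisms.IsLeftModuleHomomorphism f-linear

  module _ (U : VectorSpace K m ℓm) (V : VectorSpace K m′ ℓm′) where
    private
      module U = LeftModule U
      module V = LeftModule V

    -- Zero is preserved because it is a multiple by `0#`, and negatives because additive inverses
    -- are unique.
    mkLinear : {f : ∣_∣ K U → ∣_∣ K V} →
               (∀ {u v} → u U.≈ᴹ v → f u V.≈ᴹ f v) →
               (∀ u v → f (u U.+ᴹ v) V.≈ᴹ (f u V.+ᴹ f v)) →
               (∀ a u → f (a U.*ₗ u) V.≈ᴹ (a V.*ₗ f u)) →
               IsLinear K U V f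
    mkLinear {f} f-cong f-+ f-* = record
      { +ᴹ-isGroupHomomorphism = record
        { isMonoidHomomorphism = record
          { isMagmaHomomorphism = record
            { isRelHomomorphism = record { cong = f-cong }
            ; homo = f-+
            }
          ; ε-homo = f-0
          }
        ; ⁻¹-homo = λ u → inverseˡ-uniqueᴹ V _ _
            (V.≈ᴹ-trans (V.≈ᴹ-sym (f-+ _ _)) (V.≈ᴹ-trans (f-cong (U.-ᴹ‿inverseˡ u)) f-0))
        }
      ; *ₗ-homo = f-*
      }
      where
      f-0 : f U.0ᴹ V.≈ᴹ V.0ᴹ
      f-0 = V.≈ᴹ-trans (f-cong (U.≈ᴹ-sym (U.*ₗ-zeroˡ U.0ᴹ)))
              (V.≈ᴹ-trans (f-* 0# U.0ᴹ) (V.*ₗ-zeroˡ _))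

    linear-resp : {f g : ∣_∣ K U → ∣_∣ K V} → (∀ u → f u V.≈ᴹ g u) → IsLinear K U V f → IsLinear K U V g
    linear-resp f≈g f-linear = mkLinear
      (λ u≈v → V.≈ᴹ-trans (V.≈ᴹ-sym (f≈g _)) (V.≈ᴹ-trans (⟦⟧-cong u≈v) (f≈g _)))
      (λ u v → V.≈ᴹ-trans (V.≈ᴹ-sym (f≈g _)) (V.≈ᴹ-trans (+ᴹ-homo u v) (V.+ᴹ-cong (f≈g u) (f≈g v))))
      (λ a u → V.≈ᴹ-trans (V.≈ᴹ-sym (f≈g _)) (V.≈ᴹ-trans (*ₗ-homo a u) (V.*ₗ-cong ≈-refl (f≈g u))))
      where open Linear {U = U} {V} f-linear

  ∘-linear : (U : VectorSpace K m ℓm) (V : VectorSpace K m′ ℓm′) (W : VectorSpace K m″ ℓm″)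
             {g : ∣_∣ K V → ∣_∣ K W} {f : ∣_∣ K U → ∣_∣ K V} →
             IsLinear K V W g → IsLinear K U V f → IsLinear K U W (g ∘ f)
  ∘-linear U V W g-linear f-linear =
    Composition.isLeftModuleHomomorphism (LeftModule.≈ᴹ-trans W) f-linear g-linear

  subst-linear : (A : GradedSpace K m ℓm) (d≡e : d ≡ e) →
                 IsLinear K (A d) (A e) (subst (λ n → ∣_∣ K (A n)) d≡e)
  subst-linear {d = d} A ≡.refl =
    Identity.isLeftModuleHomomorphism (LeftModule.rawLeftModule (A d)) (LeftModule.≈ᴹ-refl (A d))

  module _ {S : Set s} (V : VectorSpace K m ℓm) where
    open LeftModule V
    open CommutativeSemigroupProperties
      (CommutativeMonoid.commutativeSemigroup +ᴹ-commutativeMonoid)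
      using (x∙yz≈y∙xz; interchange)

    linearExtension : (S → ∣_∣ K V) → FormalSum K S → ∣_∣ K V
    linearExtension f []             = 0ᴹ
    linearExtension f ((a , y) ∷ us) = a *ₗ f y +ᴹ linearExtension f us

    module _ (f : S → ∣_∣ K V) where

      -- Induction on the derivation of equality: each generating move becomes a law of the vector
      -- space `V`.
      linearExtension-cong : ∀ {us vs} → _≋_ K us vs →
                             linearExtension f us ≈ᴹ linearExtension f vs
      linearExtension-cong ≋-refl            = ≈ᴹ-refl
      linearExtension-cong (≋-sym p)         = ≈ᴹ-sym (linearExtension-cong p)
      linearExtension-cong (≋-trans p q)     =
        ≈ᴹ-trans (linearExtension-cong p) (linearExtension-cong q)
      linearExtension-cong (∷-cong a≈b p)    =
        +ᴹ-cong (*ₗ-cong a≈b ≈ᴹ-refl) (linearExtension-cong p)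
      linearExtension-cong (swap u v us)     = x∙yz≈y∙xz _ _ _
      linearExtension-cong (collect a b y us) =
        ≈ᴹ-trans (≈ᴹ-sym (+ᴹ-assoc _ _ _)) (+ᴹ-congʳ (≈ᴹ-sym (*ₗ-distribʳ (f y) a b)))
      linearExtension-cong (delete y us)     =
        ≈ᴹ-trans (+ᴹ-congʳ (*ₗ-zeroˡ (f y))) (+ᴹ-identityˡ _)

      linearExtension-linear : IsLinear K (K[_] K S) V (linearExtension f)
      linearExtension-linear = mkLinear (K[_] K S) V linearExtension-cong homo-+ homo-*
        where
        homo-+ : ∀ us vs → linearExtension f (us ++ vs) ≈ᴹ linearExtension f us +ᴹ linearExtension f vs
        homo-+ []       vs = ≈ᴹ-sym (+ᴹ-identityˡ _)
        homo-+ (_ ∷ us) vs = ≈ᴹ-trans (+ᴹ-congˡ (homo-+ us vs)) (≈ᴹ-sym (+ᴹ-assoc _ _ _))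

        homo-* : ∀ a us → linearExtension f (mapCoeff K (a *ᴷ_) us) ≈ᴹ a *ₗ linearExtension f us
        homo-* a []             = ≈ᴹ-sym (*ₗ-zeroʳ a)
        homo-* a ((b , y) ∷ us) =
          ≈ᴹ-trans (+ᴹ-cong (*ₗ-assoc a b (f y)) (homo-* a us)) (≈ᴹ-sym (*ₗ-distribˡ a _ _))

      linearExtension-basis : ∀ y → linearExtension f (basis K y) ≈ᴹ f y
      linearExtension-basis y = ≈ᴹ-trans (+ᴹ-identityʳ _) (*ₗ-identityˡ (f y))

    linear-unique-on-basis : {f g : FormalSum K S → ∣_∣ K V} →
                             IsLinear K (K[_] K S) V f → IsLinear K (K[_] K S) V g →
                             (∀ y → f (basis K y) ≈ᴹ g (basis K y)) → ∀ us → f us ≈ᴹ g us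
    linear-unique-on-basis {f} {g} f-linear g-linear f≈g = go
      where
      module F = Linear {U = K[_] K S} {V} f-linear
      module G = Linear {U = K[_] K S} {V} g-linear

      -- Scaling a basis vector produces the coefficient `a *ᴷ 1#`, which only equals `a` up to `≈`.
      term : ∀ a y us → _≋_ K ((a , y) ∷ us) (mapCoeff K (a *ᴷ_) (basis K y) ++ us)
      term a y us = ∷-cong (≈-sym (*-identityʳ a)) ≋-refl

      open SetoidReasoning ≈ᴹ-setoid

      go : ∀ us → f us ≈ᴹ g us
      go []             = ≈ᴹ-trans F.0ᴹ-homo (≈ᴹ-sym G.0ᴹ-homo)
      go ((a , y) ∷ us) = begin
        f ((a , y) ∷ us)                            ≈⟨ F.⟦⟧-cong (term a y us) ⟩
        f (mapCoeff K (a *ᴷ_) (basis K y) ++ us)    ≈⟨ F.+ᴹ-homo _ us ⟩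
        f (mapCoeff K (a *ᴷ_) (basis K y)) +ᴹ f us  ≈⟨ +ᴹ-congʳ (F.*ₗ-homo a (basis K y)) ⟩
        a *ₗ f (basis K y) +ᴹ f us                  ≈⟨ +ᴹ-cong (*ₗ-cong ≈-refl (f≈g y)) (go us) ⟩
        a *ₗ g (basis K y) +ᴹ g us                  ≈⟨ +ᴹ-congʳ (G.*ₗ-homo a (basis K y)) ⟨
        g (mapCoeff K (a *ᴷ_) (basis K y)) +ᴹ g us  ≈⟨ G.+ᴹ-homo _ us ⟨
        g (mapCoeff K (a *ᴷ_) (basis K y) ++ us)    ≈⟨ G.⟦⟧-cong (term a y us) ⟨
        g ((a , y) ∷ us)                            ∎

    -- A combination of linear maps with fixed coefficients is linear. Moving a scalar past the
    -- coefficients uses commutativity of `K`.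
    linearExtension-linear₂ : (U : VectorSpace K m′ ℓm′) (f : S → ∣_∣ K U → ∣_∣ K V) →
                              (∀ y → IsLinear K U V (f y)) →
                              ∀ us → IsLinear K U V (λ u → linearExtension (λ y → f y u) us)
    linearExtension-linear₂ U f f-linear us = mkLinear U V
      (λ u≈v → go-cong us u≈v) (λ u v → go-+ us u v) (λ a u → go-* us a u)
      where
      module U = LeftModule U
      module F (y : S) = Linear {U = U} {V} (f-linear y)
      ext : FormalSum K S → ∣_∣ K U → ∣_∣ K V
      ext us u = linearExtension (λ y → f y u) us

      go-cong : ∀ us {u v} → u U.≈ᴹ v → ext us u ≈ᴹ ext us v
      go-cong []             p = ≈ᴹ-refl
      go-cong ((a , y) ∷ us) p = +ᴹ-cong (*ₗ-cong ≈-refl (F.⟦⟧-cong y p)) (go-cong us p)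

      go-+ : ∀ us u v → ext us (u U.+ᴹ v) ≈ᴹ ext us u +ᴹ ext us v
      go-+ []             u v = ≈ᴹ-sym (+ᴹ-identityˡ 0ᴹ)
      go-+ ((a , y) ∷ us) u v =
        ≈ᴹ-trans (+ᴹ-cong (≈ᴹ-trans (*ₗ-cong ≈-refl (F.+ᴹ-homo y u v)) (*ₗ-distribˡ a _ _)) (go-+ us u v))
                 (interchange _ _ _ _)

      go-* : ∀ us b u → ext us (b U.*ₗ u) ≈ᴹ b *ₗ ext us u
      go-* []             b u = ≈ᴹ-sym (*ₗ-zeroʳ b)
      go-* ((a , y) ∷ us) b u =
        ≈ᴹ-trans (+ᴹ-cong (begin
            a *ₗ f y (b U.*ₗ u)  ≈⟨ *ₗ-cong ≈-refl (F.*ₗ-homo y b u) ⟩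
            a *ₗ (b *ₗ f y u)    ≈⟨ *ₗ-assoc a b _ ⟨
            (a *ᴷ b) *ₗ f y u    ≈⟨ *ₗ-cong (*-comm a b) ≈ᴹ-refl ⟩
            (b *ᴷ a) *ₗ f y u    ≈⟨ *ₗ-assoc b a _ ⟩
            b *ₗ (a *ₗ f y u)    ∎) (go-* us b u))
          (≈ᴹ-sym (*ₗ-distribˡ b _ _))
        where open SetoidReasoning ≈ᴹ-setoid

  extend-linear : {S : Set s₁} {S′ : Set s₂} (f : S → S′) →
                  IsLinear K (K[_] K S) (K[_] K S′) (extend K f)
  extend-linear {S = S} {S′} f = mkLinear (K[_] K S) (K[_] K S′) go homo-++ scale
    where
    go : ∀ {us vs} → _≋_ K us vs → _≋_ K (extend K f us) (extend K f vs)
    go ≋-refl            = ≋-refl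
    go (≋-sym p)         = ≋-sym (go p)
    go (≋-trans p q)     = ≋-trans (go p) (go q)
    go (∷-cong a≈b p)    = ∷-cong a≈b (go p)
    go (swap u v us)     = swap _ _ _
    go (collect a b y us) = collect a b (f y) _
    go (delete y us)     = delete (f y) _

    homo-++ : ∀ us vs → _≋_ K (extend K f (us ++ vs)) (extend K f us ++ extend K f vs)
    homo-++ us vs = LeftModule.≈ᴹ-reflexive (K[_] K S′) (map-++ _ us vs)

    scale : ∀ a us → _≋_ K (extend K f (mapCoeff K (a *ᴷ_) us)) (mapCoeff K (a *ᴷ_) (extend K f us))
    scale a us = LeftModule.≈ᴹ-reflexive (K[_] K S′) (≡.trans (≡.sym (map-∘ us)) (map-∘ us))

  record IsTrilinear
    {m₁ ℓm₁ m₂ ℓm₂ m₃ ℓm₃ m₄ ℓm₄}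
    (U : VectorSpace K m₁ ℓm₁) (V : VectorSpace K m₂ ℓm₂) (W : VectorSpace K m₃ ℓm₃)
    (Z : VectorSpace K m₄ ℓm₄) (f : ∣_∣ K U → ∣_∣ K V → ∣_∣ K W → ∣_∣ K Z) :
    Set (c ⊔ m₁ ⊔ ℓm₁ ⊔ m₂ ⊔ ℓm₂ ⊔ m₃ ⊔ ℓm₃ ⊔ ℓm₄) where
    field
      linear₁ : ∀ v w → IsLinear K U Z (λ u → f u v w)
      linear₂ : ∀ u w → IsLinear K V Z (λ v → f u v w)
      linear₃ : ∀ u v → IsLinear K W Z (λ w → f u v w)

  -- Both laws of a grafting algebra compare trilinear maps, so they need only be checked on trees;
  -- the three arguments are reduced to basis elements one after the other.
  trilinear-unique-on-bases :
    {S₁ : Set s₁} {S₂ : Set s₂} {S₃ : Set s₃} (Z : VectorSpace K m ℓm) →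
    {f g : FormalSum K S₁ → FormalSum K S₂ → FormalSum K S₃ → ∣_∣ K Z} →
    IsTrilinear (K[_] K S₁) (K[_] K S₂) (K[_] K S₃) Z f →
    IsTrilinear (K[_] K S₁) (K[_] K S₂) (K[_] K S₃) Z g →
    (∀ t v w → LeftModule._≈ᴹ_ Z (f (basis K t) (basis K v) (basis K w))
                                   (g (basis K t) (basis K v) (basis K w))) →
    ∀ us vs ws → LeftModule._≈ᴹ_ Z (f us vs ws) (g us vs ws)
  trilinear-unique-on-bases Z f-tri g-tri f≈g us vs ws =
    linear-unique-on-basis Z (F.linear₁ vs ws) (G.linear₁ vs ws) (λ t →
    linear-unique-on-basis Z (F.linear₂ _ ws) (G.linear₂ _ ws) (λ v →
    linear-unique-on-basis Z (F.linear₃ _ _) (G.linear₃ _ _) (f≈g t v) ws) vs) us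
    where
    module F = IsTrilinear f-tri
    module G = IsTrilinear g-tri

  -- The grafting algebra of coloured trees

  module _ (X : PositivelyGradedSet x) where

    private
      A : GradedSpace K _ _
      A = K[T∞,_] K X

    infixr 7 _•⟨_,_⟩_
    _•⟨_,_⟩_ : Operations K A
    _•⟨_,_⟩_ = grafting K X

    -- Exhibits the operation as one linear extension nested in another, from which linearity in
    -- each argument is inherited.
    grafting-linearExtension : ∀ i .(i≤e : i ≤ e) (us : ∣_∣ K (A d)) (vs : ∣_∣ K (A e)) →
      _≋_ K (linearExtension (A (d + e)) (λ t → extend K (t ∘⟨ i , i≤e ⟩_) vs) us) (us •⟨ i , i≤e ⟩ vs)
    grafting-linearExtension i i≤e []             vs = ≋-refl
    grafting-linearExtension {e = e} {d = d} i i≤e ((a , t) ∷ us) vs =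
      LeftModule.+ᴹ-cong (A (d + e)) (LeftModule.≈ᴹ-reflexive (A (d + e)) (≡.sym (map-∘ vs)))
                             (grafting-linearExtension i i≤e us vs)

    grafting-bilinear : ∀ i .(i≤e : i ≤ e) → IsBilinear K (A d) (A e) (A (d + e)) (λ u v → u •⟨ i , i≤e ⟩ v)
    grafting-bilinear {e = e} {d = d} i i≤e = record
      { linearˡ = λ vs → linear-resp (A d) (A (d + e)) (λ us → grafting-linearExtension i i≤e us vs)
                           (linearExtension-linear (A (d + e)) _)
      ; linearʳ = λ us → linear-resp (A e) (A (d + e)) (λ vs → grafting-linearExtension i i≤e us vs)
                           (linearExtension-linear₂ (A (d + e)) (A e) _ (λ t → extend-linear _) us)
      }

    module _ {n : ℕ} {i j : ℕ} where

      -- The equation `n≡` is a parameter so that the transports between degrees in the two laws are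
      -- covered as well.
      ••-trilinearˡ : .(i≤q : i ≤ q) .(j≤r : j ≤ r) (n≡ : p + q + r ≡ n) →
        IsTrilinear (A p) (A q) (A r) (A n)
          (λ u v w → subst (λ n → ∣_∣ K (A n)) n≡ ((u •⟨ i , i≤q ⟩ v) •⟨ j , j≤r ⟩ w))
      ••-trilinearˡ {q} {r} {p} i≤q j≤r n≡ = record
        { linear₁ = λ v w → ∘-linear (A p) (A (p + q + r)) (A n) (subst-linear A n≡)
            (∘-linear (A p) (A (p + q)) (A (p + q + r)) (J.linearˡ w) (I.linearˡ v))
        ; linear₂ = λ u w → ∘-linear (A q) (A (p + q + r)) (A n) (subst-linear A n≡)
            (∘-linear (A q) (A (p + q)) (A (p + q + r)) (J.linearˡ w) (I.linearʳ u))
        ; linear₃ = λ u v → ∘-linear (A r) (A (p + q + r)) (A n) (subst-linear A n≡)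
            (J.linearʳ (u •⟨ i , i≤q ⟩ v))
        }
        where
        module I = IsBilinear (grafting-bilinear {q} {p} i i≤q)
        module J = IsBilinear (grafting-bilinear {r} {p + q} j j≤r)

      ••-trilinearʳ : .(i≤q+r : i ≤ q + r) .(j≤r : j ≤ r) (n≡ : p + (q + r) ≡ n) →
        IsTrilinear (A p) (A q) (A r) (A n)
          (λ u v w → subst (λ n → ∣_∣ K (A n)) n≡ (u •⟨ i , i≤q+r ⟩ (v •⟨ j , j≤r ⟩ w)))
      ••-trilinearʳ {q} {r} {p} i≤q+r j≤r n≡ = record
        { linear₁ = λ v w → ∘-linear (A p) (A (p + (q + r))) (A n) (subst-linear A n≡)
            (I.linearˡ (v •⟨ j , j≤r ⟩ w))
        ; linear₂ = λ u w → ∘-linear (A q) (A (p + (q + r))) (A n) (subst-linear A n≡)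
            (∘-linear (A q) (A (q + r)) (A (p + (q + r))) (I.linearʳ u) (J.linearˡ w))
        ; linear₃ = λ u v → ∘-linear (A r) (A (p + (q + r))) (A n) (subst-linear A n≡)
            (∘-linear (A r) (A (q + r)) (A (p + (q + r))) (I.linearʳ u) (J.linearʳ v))
        }
        where
        module I = IsBilinear (grafting-bilinear {q + r} {p} i i≤q+r)
        module J = IsBilinear (grafting-bilinear {r} {q} j j≤r)

    grafting-isGraftingAlgebra : IsGraftingAlgebra K A (grafting K X)
    grafting-isGraftingAlgebra = record
      { isPreshuffleAlgebra = record
        { bilinear = grafting-bilinear
        ; assoc    = λ {p} {q} {r} us vs ws i i≤q j j≤r →
            trilinear-unique-on-bases (A (p + (q + r)))
              (••-trilinearˡ i≤q j≤r (+-assoc p q r))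
              (••-trilinearʳ (+-mono-≤ i≤q j≤r) j≤r ≡.refl)
              (λ t v w → ≋-trans
                (≋-reflexive (subst-single (+-assoc p q r)
                  (graft-assoc (tree t) (tree v) (tree w) (<-leaves-T v i≤q) (<-leaves-T w j≤r))))
                -- The coefficients are bracketed differently on the two sides of associativity. In
                -- the exchange law they agree on the nose.
                (∷-cong (*-assoc 1# 1# 1#) ≋-refl))
              us vs ws
        }
      ; exchange = λ {p} {q} {r} us vs ws i j i<j j≤r →
          -- The right-hand side of the exchange law has its first two arguments interchanged, so
          -- its trilinearity is permuted accordingly.
          let tri = ••-trilinearʳ {p = q} (shift-≤ p j≤r) (<⇒≤ (<-≤-trans i<j j≤r)) ≡.refl in
          trilinear-unique-on-bases (A (q + (p + r)))
            (••-trilinearʳ (≤-trans (<⇒≤ (<-≤-trans i<j j≤r)) (m≤n+m r q)) j≤r (swap-degrees p q r))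
            (record { linear₁ = λ v w → IsTrilinear.linear₂ tri v w
                    ; linear₂ = λ u w → IsTrilinear.linear₁ tri u w
                    ; linear₃ = λ u v → IsTrilinear.linear₃ tri v u })
            (λ t v w → ≋-reflexive (subst-single (swap-degrees p q r)
                (graft-exchange (tree t) (tree v) (tree w) (leaves-T t) i<j (<-leaves-T w j≤r))))
            us vs ws
      }
      where
      ≋-reflexive : ∀ {n} {us vs : ∣_∣ K (A n)} → us ≡ vs → _≋_ K us vs
      ≋-reflexive {n} = LeftModule.≈ᴹ-reflexive (A n)

-- The evaluation of trees in a grafting algebra

-- A bare leaf would have degree 0, which `T` excludes, so the junk value of `eval` never occurs on
-- elements of `T`.
leaf∉T : 1 ≡ suc n → 1 ≤ n → ⊥
leaf∉T ≡.refl ()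

module HomogeneousElements (K : HeytingField c ℓ₁ ℓ₂) (A : GraftingAlgebra K m ℓm) where

  open GraftingAlgebra A

  private
    module V (n : ℕ) = LeftModule (space n)

  -- Elements are bundled with their degrees so that equations across propositionally equal degrees
  -- can be chained without transports.
  H : Set m
  H = Σ[ n ∈ ℕ ] ∣_∣ K (space n)

  deg : H → ℕ
  deg = proj₁

  infix 4 _~_

  data _~_ : H → H → Set (m ⊔ ℓm) where
    ≈⇒~ : ∀ {n u v} → V._≈ᴹ_ n u v → (n , u) ~ (n , v)

  ≈[]⇒~ : ∀ {u v} (d≡e : d ≡ e) → _≈[_]_ K space u d≡e v → (d , u) ~ (e , v)
  ≈[]⇒~ ≡.refl p = ≈⇒~ p

  -- The match discards an equation `n ≡ n` of degrees, hence rests on uniqueness of identity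
  -- proofs.
  ~⇒≈ : ∀ {n u v} → (n , u) ~ (n , v) → V._≈ᴹ_ n u v
  ~⇒≈ (≈⇒~ p) = p

  ~-setoid : Setoid m (m ⊔ ℓm)
  ~-setoid = record
    { Carrier = H
    ; _≈_ = _~_
    ; isEquivalence = record
      { refl  = ≈⇒~ (V.≈ᴹ-refl _)
      ; sym   = λ { (≈⇒~ p) → ≈⇒~ (V.≈ᴹ-sym _ p) }
      ; trans = λ { (≈⇒~ p) (≈⇒~ q) → ≈⇒~ (V.≈ᴹ-trans _ p q) }
      }
    }

  open Setoid ~-setoid public using ()
    renaming (refl to ~-refl; sym to ~-sym; trans to ~-trans; reflexive to ~-reflexive)

  operation : ∀ {d e i} → Dec (i ≤ e) → ∣_∣ K (space d) → ∣_∣ K (space e) → ∣_∣ K (space (d + e))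
  operation {i = i} (yes i≤e) u v = u •⟨ i , i≤e ⟩ v
  operation         (no _)    u v = V.0ᴹ _

  infixr 7 _•[_]_

  -- Total version of •ᵢ, with the junk value 0 for i > deg h.
  _•[_]_ : H → ℕ → H → H
  (d , u) •[ i ] (e , v) = d + e , operation (i ≤? e) u v

  •-≡ : ∀ {d e i} .(i≤e : i ≤ e) {u v} → (d , u) •[ i ] (e , v) ≡ (d + e , u •⟨ i , i≤e ⟩ v)
  •-≡ {e = e} {i} i≤e with i ≤? e
  ... | yes _  = ≡.refl
  ... | no i≰e = contradiction-irr i≤e i≰e

  •-cong : ∀ {g g′} i {h h′} → g ~ g′ → h ~ h′ → g •[ i ] h ~ g′ •[ i ] h′
  •-cong {d , u} i {e , v} {_ , v′} (≈⇒~ p) (≈⇒~ q) with i ≤? e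
  ... | yes i≤e = ≈⇒~ (V.≈ᴹ-trans _
          (⟦⟧-cong {U = space d} {space (d + e)}
            (IsBilinear.linearˡ (bilinear i i≤e) v) p)
          (⟦⟧-cong {U = space e} {space (d + e)}
            (IsBilinear.linearʳ (bilinear i i≤e) _) q))
        where open LinearAlgebra.Linear K using (⟦⟧-cong)
  ... | no _    = ~-refl

  •-assoc : ∀ f {i} g {j} h → i ≤ deg g → j ≤ deg h →
            (f •[ i ] g) •[ j ] h ~ f •[ i + j ] (g •[ j ] h)
  •-assoc (p , u) {i} (q , v) {j} (r , w) i≤q j≤r = begin
    ((p , u) •[ i ] (q , v)) •[ j ] (r , w)
      ≡⟨ cong (_•[ j ] (r , w)) (•-≡ i≤q) ⟩
    (p + q , u •⟨ i , i≤q ⟩ v) •[ j ] (r , w)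
      ≡⟨ •-≡ j≤r ⟩
    (p + q + r , (u •⟨ i , i≤q ⟩ v) •⟨ j , j≤r ⟩ w)
      ≈⟨ ≈[]⇒~ (+-assoc p q r) (assoc u v w i i≤q j j≤r) ⟩
    (p + (q + r) , u •⟨ i + j , +-mono-≤ i≤q j≤r ⟩ (v •⟨ j , j≤r ⟩ w))
      ≡⟨ •-≡ (+-mono-≤ i≤q j≤r) ⟨
    (p , u) •[ i + j ] (q + r , v •⟨ j , j≤r ⟩ w)
      ≡⟨ cong ((p , u) •[ i + j ]_) (•-≡ j≤r) ⟨
    (p , u) •[ i + j ] ((q , v) •[ j ] (r , w)) ∎
    where open SetoidReasoning ~-setoid

  •-exchange : ∀ f {i} g {j} h → i < j → j ≤ deg h →
               f •[ i ] (g •[ j ] h) ~ g •[ j + deg f ] (f •[ i ] h)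
  •-exchange (p , u) {i} (q , v) {j} (r , w) i<j j≤r = begin
    (p , u) •[ i ] ((q , v) •[ j ] (r , w))
      ≡⟨ cong ((p , u) •[ i ]_) (•-≡ j≤r) ⟩
    (p , u) •[ i ] (q + r , v •⟨ j , j≤r ⟩ w)
      ≡⟨ •-≡ (≤-trans i≤r (m≤n+m r q)) ⟩
    (p + (q + r) , u •⟨ i , ≤-trans i≤r (m≤n+m r q) ⟩ (v •⟨ j , j≤r ⟩ w))
      ≈⟨ ≈[]⇒~ (swap-degrees p q r) (exchange u v w i j i<j j≤r) ⟩
    (q + (p + r) , v •⟨ j + p , shift-≤ p j≤r ⟩ (u •⟨ i , i≤r ⟩ w))
      ≡⟨ •-≡ (shift-≤ p j≤r) ⟨
    (q , v) •[ j + p ] (p + r , u •⟨ i , i≤r ⟩ w)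
      ≡⟨ cong ((q , v) •[ j + p ]_) (•-≡ i≤r) ⟨
    (q , v) •[ j + p ] ((p , u) •[ i ] (r , w)) ∎
    where
    open SetoidReasoning ~-setoid
    i≤r : i ≤ r
    i≤r = <⇒≤ (<-≤-trans i<j j≤r)

  module Evaluation (X : PositivelyGradedSet x) (φ : ∀ n → Elem X n → ∣_∣ K (space n)) where

    -- The tree without vertices acts as the identity although A need not have a
    -- unit, so only eval leaf is a junk value.
    mutual
      eval : PlanarTree X → H
      eval leaf            = 0 , V.0ᴹ 0
      eval (node {k} y ts) = actᵛ ts 0 (k , φ k y)

      act : PlanarTree X → ℕ → H → H
      act leaf          i h = h
      act (node y ts) i h = eval (node y ts) •[ i ] h

      actᵛ : Vec (PlanarTree X) k → ℕ → H → H
      actᵛ []       i h = h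
      actᵛ (t ∷ ts) i h = act t i (actᵛ ts (suc i) h)

    mutual
      deg-eval : ∀ t → suc (deg (eval t)) ≡ leaves t
      deg-eval leaf            = ≡.refl
      deg-eval (node {k} y ts) = +-cancelʳ-≡ k _ _ (≡.trans (≡.sym (+-suc _ k)) (deg-actᵛ ts 0 _))

      deg-act : ∀ t i h → suc (deg (act t i h)) ≡ leaves t + deg h
      deg-act leaf          i h = ≡.refl
      deg-act t@(node _ _) i h = cong (_+ deg h) (deg-eval t)

      -- Each of the `k` trees raises the degree by one less than its number of leaves; adding `k`
      -- avoids subtraction.
      deg-actᵛ : (ts : Vec (PlanarTree X) k) → ∀ i h → deg (actᵛ ts i h) + k ≡ leavesᵛ ts + deg h
      deg-actᵛ []       i h = +-identityʳ _
      deg-actᵛ {k = suc k} (t ∷ ts) i h = begin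
        deg (act t i (actᵛ ts (suc i) h)) + suc k     ≡⟨ +-suc _ k ⟩
        suc (deg (act t i (actᵛ ts (suc i) h))) + k   ≡⟨ cong (_+ k) (deg-act t i _) ⟩
        leaves t + deg (actᵛ ts (suc i) h) + k        ≡⟨ +-assoc (leaves t) _ k ⟩
        leaves t + (deg (actᵛ ts (suc i) h) + k)      ≡⟨ cong (leaves t +_) (deg-actᵛ ts (suc i) h) ⟩
        leaves t + (leavesᵛ ts + deg h)               ≡⟨ +-assoc (leaves t) _ _ ⟨
        leavesᵛ (t ∷ ts) + deg h                      ∎
        where open ≡.≡-Reasoning

    deg-actᵛ-≥ : (ts : Vec (PlanarTree X) k) → ∀ i h → deg h ≤ deg (actᵛ ts i h)
    deg-actᵛ-≥ {k = k} ts i h = +-cancelˡ-≤ k _ _ (begin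
      k + deg h                ≤⟨ +-monoˡ-≤ (deg h) (leavesᵛ-≥ ts) ⟩
      leavesᵛ ts + deg h       ≡⟨ deg-actᵛ ts i h ⟨
      deg (actᵛ ts i h) + k    ≡⟨ +-comm _ k ⟩
      k + deg (actᵛ ts i h)    ∎)
      where open ≤-Reasoning

    act-cong : ∀ t {i g h} → g ~ h → act t i g ~ act t i h
    act-cong leaf         p = p
    act-cong (node _ _) {i} p = •-cong i ~-refl p

    actᵛ-cong : (ts : Vec (PlanarTree X) k) → ∀ {i g h} → g ~ h → actᵛ ts i g ~ actᵛ ts i h
    actᵛ-cong []       p = p
    actᵛ-cong (t ∷ ts) p = act-cong t (actᵛ-cong ts p)

    act-• : ∀ t {i} g {j} h → i ≤ deg g → j ≤ deg h → act t i g •[ j ] h ~ act t (i + j) (g •[ j ] h)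
    act-• leaf         g h _ _ = ~-refl
    act-• (node _ _) g h p q = •-assoc _ g h p q

    -- The index `suc (i + j)` is the general one strictly to the right of `j`, and acting by `w`
    -- moves it by `leaves w - 1`. For two trees with vertices this is the exchange law; if either
    -- is a leaf, both sides coincide.
    act-exchange : ∀ t w i j h → suc (i + j) ≤ deg h →
                   act w j (act t (suc (i + j)) h) ~ act t (leaves w + i + j) (act w j h)
    act-exchange leaf         w            i j h p = ~-refl
    act-exchange (node _ _) leaf         i j h p = ~-refl
    act-exchange t@(node _ _) w@(node _ _) i j h p = begin
      eval w •[ j ] (eval t •[ suc (i + j) ] h)
        ≈⟨ •-exchange (eval w) (eval t) h (s≤s (m≤n+m j i)) p ⟩
      eval t •[ suc (i + j) + deg (eval w) ] (eval w •[ j ] h)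
        ≡⟨ cong (λ l → eval t •[ l ] (eval w •[ j ] h)) index ⟩
      eval t •[ leaves w + i + j ] (eval w •[ j ] h) ∎
      where
      open SetoidReasoning ~-setoid
      rearrange : ∀ i j d → suc (i + j) + d ≡ suc d + i + j
      rearrange = solve-∀
      index : suc (i + j) + deg (eval w) ≡ leaves w + i + j
      index = ≡.trans (rearrange i j _) (cong (λ l → l + i + j) (deg-eval w))

    mutual
      -- At a vertex, `eval-graft` extracts `t` from the evaluation of the grafted tree, and
      -- associativity then moves it outside the action on `h`.
      act-graft : ∀ t w {i j} h → i < leaves w → j ≤ deg h →
                  act (graft t i w) j h ~ act t (i + j) (act w j h)
      act-graft t leaf {zero}  h _ _ = ~-refl
      act-graft t leaf {suc _} h (s≤s ()) _
      act-graft t w@(node y ws) {i} {j} h i<w j≤h = begin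
        eval (node y (graftᵛ t i ws)) •[ j ] h ≈⟨ •-cong j (eval-graft t y ws i<w) ~-refl ⟩
        act t i (eval w) •[ j ] h
          ≈⟨ act-• t (eval w) h (s≤s⁻¹ (≤-trans i<w (≤-reflexive (≡.sym (deg-eval w))))) j≤h ⟩
        act t (i + j) (eval w •[ j ] h)        ∎
        where open SetoidReasoning ~-setoid

      eval-graft : ∀ t {k} (y : Elem X k) ws {i} → i < leavesᵛ ws →
                   eval (node y (graftᵛ t i ws)) ~ act t i (eval (node y ws))
      eval-graft t {k} y ws {i} i<ws =
        ~-trans (act-graftᵛ t ws _ i<ws ≤-refl)
                (~-reflexive (cong (λ i → act t i (eval (node y ws))) (+-identityʳ i)))

      -- If leaf `i` lies in the first tree, `act-graft` applies to it; otherwise `t` comes out of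
      -- the remaining trees by induction and passes the first one by exchange. The bound on `j + k`
      -- says that the trees act on `k` consecutive leaves of `h`, counted from `j`.
      act-graftᵛ : ∀ t (ws : Vec (PlanarTree X) k) {i j} h → i < leavesᵛ ws → j + k ≤ suc (deg h) →
                   actᵛ (graftᵛ t i ws) j h ~ act t (i + j) (actᵛ ws j h)
      act-graftᵛ {k = suc k} t (w ∷ ws) {i} {j} h i<ws j+k≤ with split (leaves w) i
      ... | inj₁ i<w = begin
        actᵛ (graftᵛ t i (w ∷ ws)) j h                ≡⟨ cong (λ ws → actᵛ ws j h) (graftᵛ-hit t w ws i<w) ⟩
        act (graft t i w) j (actᵛ ws (suc j) h)       ≈⟨ act-graft t w _ i<w j≤ ⟩
        act t (i + j) (act w j (actᵛ ws (suc j) h))   ∎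
        where
        open SetoidReasoning ~-setoid
        j≤ : j ≤ deg (actᵛ ws (suc j) h)
        j≤ = ≤-trans (m+n≤o⇒m≤o j (s≤s⁻¹ (≤-trans (≤-reflexive (≡.sym (+-suc j k))) j+k≤)))
                     (deg-actᵛ-≥ ws (suc j) h)
      ... | inj₂ (i′ , ≡.refl) = begin
        actᵛ (graftᵛ t i (w ∷ ws)) j h
          ≡⟨ cong (λ ws → actᵛ ws j h) (graftᵛ-skip t i′ w ws) ⟩
        act w j (actᵛ (graftᵛ t i′ ws) (suc j) h)
          ≈⟨ act-cong w (act-graftᵛ t ws h i′< suc-j+k≤) ⟩
        act w j (act t (i′ + suc j) (actᵛ ws (suc j) h))
          ≡⟨ cong (λ l → act w j (act t l (actᵛ ws (suc j) h))) (+-suc i′ j) ⟩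
        act w j (act t (suc (i′ + j)) (actᵛ ws (suc j) h))
          ≈⟨ act-exchange t w i′ j _ i′+j< ⟩
        act t (leaves w + i′ + j) (act w j (actᵛ ws (suc j) h)) ∎
        where
        open SetoidReasoning ~-setoid
        suc-j+k≤ : suc j + k ≤ suc (deg h)
        suc-j+k≤ = ≤-trans (≤-reflexive (≡.sym (+-suc j k))) j+k≤
        i′< : i′ < leavesᵛ ws
        i′< = +-cancelˡ-< (leaves w) _ _ i<ws
        i′+j< : suc (i′ + j) ≤ deg (actᵛ ws (suc j) h)
        i′+j< = +-cancelʳ-≤ k _ _ (≤-trans
          (≤-reflexive (+-assoc (suc i′) j k))
          (≤-trans (+-mono-≤ i′< (s≤s⁻¹ suc-j+k≤)) (≤-reflexive (≡.sym (deg-actᵛ ws (suc j) h)))))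

    act-T : (t : T X d) → ∀ i h → act (tree t) i h ≡ eval (tree t) •[ i ] h
    act-T (mkT leaf l p)       i h = ⊥-elim-irr (leaf∉T l p)
    act-T (mkT (node _ _) _ _) i h = ≡.refl

    eval-∘ : ∀ (t : T X d) (w : T X e) i .(i≤e : i ≤ e) →
             eval (tree (t ∘⟨ i , i≤e ⟩ w)) ~ eval (tree t) •[ i ] eval (tree w)
    eval-∘ t (mkT leaf l p)        i i≤e = ⊥-elim-irr (leaf∉T l p)
    eval-∘ {e = e} t w@(mkT (node y ws) _ _) i i≤e =
      ~-trans (eval-graft (tree t) y ws (<-leaves-T w (recompute (i ≤? e) i≤e)))
              (~-reflexive (act-T t i (eval (tree w))))

    evalᵀ : T X n → ∣_∣ K (space n)
    evalᵀ t = subst (λ n → ∣_∣ K (space n)) (suc-injective (≡.trans (deg-eval (tree t)) (leaves-T t)))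
                    (proj₂ (eval (tree t)))

    evalᵀ~eval : (t : T X n) → (n , evalᵀ t) ~ eval (tree t)
    evalᵀ~eval t = ~-sym (≈[]⇒~ _ (V.≈ᴹ-refl _))

    evalᵀ-∘ : ∀ (t : T X d) (w : T X e) i .(i≤e : i ≤ e) →
              V._≈ᴹ_ (d + e) (evalᵀ (t ∘⟨ i , i≤e ⟩ w)) (evalᵀ t •⟨ i , i≤e ⟩ evalᵀ w)
    evalᵀ-∘ {d} {e} t w i i≤e = ~⇒≈ (begin
      (d + e , evalᵀ (t ∘⟨ i , i≤e ⟩ w))         ≈⟨ evalᵀ~eval (t ∘⟨ i , i≤e ⟩ w) ⟩
      eval (tree (t ∘⟨ i , i≤e ⟩ w))             ≈⟨ eval-∘ t w i i≤e ⟩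
      eval (tree t) •[ i ] eval (tree w)         ≈⟨ •-cong i (evalᵀ~eval t) (evalᵀ~eval w) ⟨
      (d , evalᵀ t) •[ i ] (e , evalᵀ w)         ≡⟨ •-≡ i≤e ⟩
      (d + e , evalᵀ t •⟨ i , i≤e ⟩ evalᵀ w)     ∎)
      where open SetoidReasoning ~-setoid

    actᵛ-leaves : ∀ k i h → actᵛ (replicate k leaf) i h ≡ h
    actᵛ-leaves zero    i h = ≡.refl
    actᵛ-leaves (suc k) i h = actᵛ-leaves k (suc i) h

    evalᵀ-corolla : ∀ n (y : Elem X n) → V._≈ᴹ_ n (evalᵀ (corolla y)) (φ n y)
    evalᵀ-corolla n y = ~⇒≈ (~-trans (evalᵀ~eval (corolla y)) (~-reflexive (actᵛ-leaves (suc n) 0 _)))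

    evaluation : GradedMap K X A
    evaluation n = LinearAlgebra.linearExtension K (space n) evalᵀ

    evaluation-basis : (t : T X n) → V._≈ᴹ_ n (evaluation n (basis K t)) (evalᵀ t)
    evaluation-basis {n} t = LinearAlgebra.linearExtension-basis K (space n) evalᵀ t

    evaluation-extends : Extends K X A φ evaluation
    evaluation-extends = record
      { linear   = λ n → LinearAlgebra.linearExtension-linear K (space n) evalᵀ
      ; grafts   = λ {d} {e} t w i i≤e → V.≈ᴹ-trans (d + e) (evaluation-basis (t ∘⟨ i , i≤e ⟩ w))
          (V.≈ᴹ-trans (d + e) (evalᵀ-∘ t w i i≤e)
          (V.≈ᴹ-sym (d + e) (•⟨⟩-cong i i≤e (evaluation-basis t) (evaluation-basis w))))
      ; corollas = λ n y → V.≈ᴹ-trans n (evaluation-basis (corolla y)) (evalᵀ-corolla n y)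
      }
      where
      •⟨⟩-cong : ∀ {d e} i .(i≤e : i ≤ e) {u u′ v v′} → V._≈ᴹ_ d u u′ → V._≈ᴹ_ e v v′ →
                 V._≈ᴹ_ (d + e) (u •⟨ i , i≤e ⟩ v) (u′ •⟨ i , i≤e ⟩ v′)
      •⟨⟩-cong i i≤e p q = ~⇒≈ (~-trans (~-reflexive (≡.sym (•-≡ i≤e)))
        (~-trans (•-cong i (≈⇒~ p) (≈⇒~ q)) (~-reflexive (•-≡ i≤e))))

    -- Uniqueness of the extension

    module _ (Ψ : GradedMap K X A) (Ψ-extends : Extends K X A φ Ψ) where
      open Extends Ψ-extends

      image : T X n → H
      image {n} t = n , Ψ n (basis K t)

      -- The number of leaves determines the degree, and the remaining fields are irrelevant.
      image-cong : (t : T X d) (u : T X e) → tree t ≡ tree u → image t ≡ image u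
      image-cong (mkT t l _) (mkT .t l′ _) ≡.refl
        with ≡.refl ← suc-injective (≡.trans (≡.sym (recompute (_ ≟ _) l)) (recompute (_ ≟ _) l′)) = ≡.refl

      image-∘ : ∀ (t : T X d) (w : T X e) i .(i≤e : i ≤ e) →
                image (t ∘⟨ i , i≤e ⟩ w) ~ image t •[ i ] image w
      image-∘ t w i i≤e = ~-trans (≈⇒~ (grafts t w i i≤e)) (~-reflexive (≡.sym (•-≡ i≤e)))

      mutual
        -- The tree is rebuilt from the corolla of its root, on which `Ψ` is prescribed, and
        -- `image~act` turns each grafting of a child into an action. Keeping the bare tree `t`
        -- apart from `u` makes the recursion structural.
        image~eval : ∀ t (u : T X n) → tree u ≡ t → image u ~ eval t
        image~eval leaf (mkT .leaf l p) ≡.refl = ⊥-elim-irr (leaf∉T l p)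
        image~eval (node {k} y ts) u u≡ = ~-trans
          (image~act ts 0 (corolla y) u (≡.trans u≡ (≡.sym (graftAll-corolla y ts))) ≤-refl)
          (actᵛ-cong ts (≈⇒~ (corollas k y)))

        image~act : ∀ {m} (ts : Vec (PlanarTree X) m) i (w : T X e) (u : T X n) →
                    tree u ≡ graftAll i ts (tree w) → i + m ≤ suc e →
                    image u ~ actᵛ ts i (image w)
        image~act []       i w u u≡ _ = ~-reflexive (image-cong u w u≡)
        image~act (leaf ∷ ts) i w u u≡ p =
          image~act ts (suc i) w u (≡.trans u≡ (graft-leaf i _)) (≤-trans (≤-reflexive (≡.sym (+-suc i _))) p)
        image~act {e = e} {m = suc m} (t@(node y ts′) ∷ ts) i w u u≡ p = begin
          image u                                     ≡⟨ image-cong u (t′ ∘⟨ i , i≤n ⟩ v) u≡′ ⟩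
          image (t′ ∘⟨ i , i≤n ⟩ v)                   ≈⟨ image-∘ t′ v i i≤n ⟩
          image t′ •[ i ] image v
            ≈⟨ •-cong i (image~eval t t′ ≡.refl) (image~act ts (suc i) w v v≡ suc-i+m≤) ⟩
          eval t •[ i ] actᵛ ts (suc i) (image w)     ∎
          where
          open SetoidReasoning ~-setoid
          suc-i+m≤ : suc i + m ≤ suc e
          suc-i+m≤ = ≤-trans (≤-reflexive (≡.sym (+-suc i m))) p
          -- The tree before the last grafting, as an element of `T`, so that compatibility of `Ψ`
          -- with grafting can be applied to it.
          grafted : Σ[ n ∈ ℕ ] Σ[ v ∈ T X n ] tree v ≡ graftAll (suc i) ts (tree w) × e ≤ n
          grafted = graftAllᵀ (suc i) ts w suc-i+m≤
          v : T X (proj₁ grafted)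
          v = proj₁ (proj₂ grafted)
          v≡ : tree v ≡ graftAll (suc i) ts (tree w)
          v≡ = proj₁ (proj₂ (proj₂ grafted))
          t′ : T X (leavesᵛ ts′ ∸ 1)
          t′ = nodeᵀ y ts′
          i≤n : i ≤ proj₁ grafted
          i≤n = ≤-trans (m+n≤o⇒m≤o i (s≤s⁻¹ suc-i+m≤)) (proj₂ (proj₂ (proj₂ grafted)))
          u≡′ : tree u ≡ graft t i (tree v)
          u≡′ = ≡.trans u≡ (cong (graft t i) (≡.sym v≡))

      evaluation-unique : ∀ n v → V._≈ᴹ_ n (Ψ n v) (evaluation n v)
      evaluation-unique n = LinearAlgebra.linear-unique-on-basis K (space n) (linear n)
        (LinearAlgebra.linearExtension-linear K (space n) evalᵀ)
        (λ t → V.≈ᴹ-trans n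
          (~⇒≈ (~-trans (image~eval (tree t) t ≡.refl) (~-sym (evalᵀ~eval t))))
          (V.≈ᴹ-sym n (evaluation-basis t)))

-- Binary trees

-- The only colour has degree 1, so matching on it forces exactly two children.
toBinary : PlanarTree oneGenerator → Binary.Tree ⊤ ⊤
toBinary leaf                    = Binary.leaf tt
toBinary (node gen (l ∷ r ∷ [])) = Binary.node (toBinary l) tt (toBinary r)

fromBinary-toBinary : ∀ t → fromBinary (toBinary t) ≡ t
fromBinary-toBinary leaf                    = ≡.refl
fromBinary-toBinary (node gen (l ∷ r ∷ [])) =
  cong₂ (λ l r → node gen (l ∷ r ∷ [])) (fromBinary-toBinary l) (fromBinary-toBinary r)

toBinary-fromBinary : ∀ b → toBinary (fromBinary b) ≡ b
toBinary-fromBinary (Binary.leaf _)     = ≡.refl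
toBinary-fromBinary (Binary.node l _ r) =
  cong₂ (λ l r → Binary.node l tt r) (toBinary-fromBinary l) (toBinary-fromBinary r)

uncolour : T oneGenerator n → BinaryTree n
uncolour (mkT t l p) = mkB (toBinary t)
  (≡.trans (≡.sym (leaves-fromBinary (toBinary t))) (≡.trans (cong leaves (fromBinary-toBinary t)) l)) p

mkB-cong : ∀ {b b′} .{l : #leaves b ≡ suc n} .{l′ : #leaves b′ ≡ suc n} .{p : 1 ≤ n} →
           b ≡ b′ → mkB b l p ≡ mkB b′ l′ p
mkB-cong ≡.refl = ≡.refl

uncolour-colour : (b : BinaryTree n) → uncolour (colour b) ≡ b
uncolour-colour (mkB b _ _) = mkB-cong (toBinary-fromBinary b)

colour-uncolour : (t : T oneGenerator n) → colour (uncolour t) ≡ t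
colour-uncolour t@(mkT t′ _ _) = T-≡ ≡.refl (fromBinary-toBinary t′)

module _ (K : HeytingField c ℓ₁ ℓ₂) where

  extend-inverse : {S : Set s₁} {S′ : Set s₂} {f : S → S′} {g : S′ → S} → (∀ y → f (g y) ≡ y) →
                   ∀ us → extend K f (extend K g us) ≡ us
  extend-inverse f∘g us =
    ≡.trans (≡.sym (map-∘ us)) (≡.trans (map-cong (λ (a , y) → cong (a ,_) (f∘g y)) us) (map-id us))

  extend-isLinearIso : {S : Set s₁} {S′ : Set s₂} (f : S → S′) (g : S′ → S) →
                       (∀ y → f (g y) ≡ y) → (∀ y → g (f y) ≡ y) →
                       IsLinearIso K (K[_] K S) (K[_] K S′) (extend K f)
  extend-isLinearIso {S = S} {S′} f g f∘g g∘f = record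
    { isLeftModuleMonomorphism = record
      { isLeftModuleHomomorphism = extend-linear f
      ; injective = λ {us} {vs} fus≋fvs → subst₂ (_≋_ K) (extend-inverse g∘f us) (extend-inverse g∘f vs)
                                            (extend-cong g fus≋fvs)
      }
    ; surjective = λ vs → extend K g vs , λ {us} us≋ →
        subst (_≋_ K (extend K f us)) (extend-inverse f∘g vs) (extend-cong f us≋)
    }
    where
    open LinearAlgebra K
    extend-cong : ∀ {s₁ s₂} {S : Set s₁} {S′ : Set s₂} (f : S → S′) {us vs} →
                  _≋_ K us vs → _≋_ K (extend K f us) (extend K f vs)
    extend-cong {S = S} {S′} f = Linear.⟦⟧-cong {U = K[_] K S} {K[_] K S′} (extend-linear f)

mainTheorem16 : ∀ {c ℓ₁ ℓ₂ x a ℓa : Level} (K : HeytingField c ℓ₁ ℓ₂) (X : PositivelyGradedSet x) →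
    IsGraftingAlgebra K (K[T∞,_] K X) (grafting K X)
    ×
    ((A : GraftingAlgebra K a ℓa) (φ : ∀ n → Elem X n → ∣_∣ K (GraftingAlgebra.space A n)) →
    Σ[ Φ ∈ GradedMap K X A ]
    Extends K X A φ Φ
    ×
    (∀ (Ψ : GradedMap K X A) → Extends K X A φ Ψ →
    ∀ n v → LeftModule._≈ᴹ_ (GraftingAlgebra.space A n) (Ψ n v) (Φ n v)))
    ×
    (∀ n → IsLinearIso K (K[_] K (BinaryTree n)) (K[_] K (T oneGenerator n)) (extend K colour))
mainTheorem16 K X =
  LinearAlgebra.grafting-isGraftingAlgebra K X ,
  (λ A φ → let open HomogeneousElements.Evaluation K A X φ in
           evaluation , evaluation-extends , evaluation-unique) ,
  (λ n → extend-isLinearIso K colour uncolour colour-uncolour uncolour-colour)
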